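{- Let $\mathsf{L}$ be classical propositional logic over an infinite set of atomic propositions, and let all privacy configurations be atomic. Then a continuous and non-refusing censor cannot be at the same time effective and minimally invasive. That is, there is no censor that is simultaneously continuous, non-refusing, effective, and minimally invasive.
   Context: Logic. $\mathsf{Fml}_{\mathsf L}$ is the set of classical propositional formulas over the given atoms, and $\Gamma\vdash_{\mathsf L}A$ is the usual classical derivability of the formula $A$ from the set of formulas $\Gamma$. A set $\Gamma$ is $\mathsf L$-consistent if $\Gamma\not\vdash_{\mathsf L}A$ for some formula $A$. Modal logic $\mathsf M$ over $\mathsf L$. The set $\mathsf{Fml}_{\mathsf M}$ is generated by: $\Box A$ for $A\in\mathsf{Fml}_{\mathsf L}$; $\bot$; $A\to B$ for $A,B\in\mathsf{Fml}_{\mathsf M}$. The connectives $\top,\neg,\land,\lor$ are defined classically from these. An $\mathsf M$-model is any set $\mathcal M\subseteq\mathcal P(\mathsf{Fml}_{\mathsf L})$. Truth: $\mathcal M\Vdash\Box A$ iff $w\vdash_{\mathsf L}A$ for all $w\in\mathcal M$; $\mathcal M\not\Vdash\bot$; $\mathcal M\Vdash A\to B$ iff $\mathcal M\not\Vdash A$ or $\mathcal M\Vdash B$. For $\Gamma\subseteq\mathsf{Fml}_{\mathsf M}$: $\mathcal M\Vdash\Gamma$ iff $\mathcal M\Vdash A$ for all $A\in\Gamma$; $\Gamma$ is satisfiable iff $\mathcal M\Vdash\Gamma$ for some $\mathsf M$-model $\mathcal M$; $\Gamma\models A$ iff every $\mathsf M$-model $\mathcal M$ with $\mathcal M\Vdash\Gamma$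 has $\mathcal M\Vdash A$. Privacy configuration. A triple $(\mathsf{KB},\mathsf{AK},\mathsf{Sec})$ with $\mathsf{KB}\subseteq\mathsf{Fml}_{\mathsf L}$, $\mathsf{AK}\subseteq\mathsf{Fml}_{\mathsf M}$, $\mathsf{Sec}\subseteq\mathsf{Fml}_{\mathsf L}$ such that $\mathsf{KB}$ is $\mathsf L$-consistent, $\{\mathsf{KB}\}\Vdash\mathsf{AK}$ (the one-element model $\{\mathsf{KB}\}$), and $\mathsf{AK}\not\models\Box s$ for each $s\in\mathsf{Sec}$. Atomic privacy configurations. A privacy configuration is atomic if every element of $\mathsf{KB}$ is of the form $p$ or $\neg p$ with $p$ an atomic proposition, and this is a priori knowledge: for all literals $l,l'$ over two distinct atoms, $\Box(l\to l')\to(\Box\bar l\lor\Box l')\in\mathsf{AK}$, where $\bar l$ is the complementary literal of $l$ ($\bar p=\neg p$, $\overline{\neg p}=p$). Standing assumption: in this statement all privacy configurations are atomic; censors are defined on, and all properties below quantify over, atomic privacy configurations $P=(\mathsf{KB},\mathsf{AK},\mathsf{Sec})$. Evaluation and censors. $\mathsf{eval}(\mathsf{KB},q)=t$ if $\mathsf{KB}\vdash_{\mathsf L}q$, and $=u$ otherwise. The answer set is $\mathbb A=\{t,u,r\}$ (three distinct values; $r$ means refusal). $X^\omega$ is the set of infinite sequences $(s_1,s_2,\dots)$ over $X$; $s|_n=(s_1,\dots,s_n)$. A censor $\mathsf{Cens}$ assigns to each privacy configuration $P$ a function $\mathsf{Cens}_P:\mathsf{Fml}_{\mathsf L}^\omega\to\mathbb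 A^\omega$. Elements of $\mathsf{Fml}_{\mathsf L}^\omega$ are called query sequences. Content. $\mathsf{cont}(q,t)=\Box q$, $\mathsf{cont}(q,u)=\neg\Box q$, $\mathsf{cont}(q,r)=\top$; and for a query sequence $q$ with answers $a=\mathsf{Cens}_P(q)$, $\mathsf{cont}(\mathsf{Cens}_P(q),n)=\{\mathsf{cont}(q_i,a_i):1\le i\le n\}\cup\mathsf{AK}$. Properties of a censor $\mathsf{Cens}$. - Continuous: for each $P$, all query sequences $q,q'$ and all $n$, $q|_n=q'|_n$ implies $\mathsf{Cens}_P(q)|_n=\mathsf{Cens}_P(q')|_n$. - Non-refusing: it never assigns the answer $r$ to a query. - Credible: for each $P$, $q$, $n$, the set $\mathsf{cont}(\mathsf{Cens}_P(q),n)$ is satisfiable. - Effective: for each $P$, $q$, $n$ and each $s\in\mathsf{Sec}$, $\mathsf{cont}(\mathsf{Cens}_P(q),n)\not\models\Box s$. - Minimally invasive: $\mathsf{Cens}$ is effective and credible, and for each $P$, each $q$ and each $i\ge1$ with $\mathsf{Cens}_P(q)_i\ne\mathsf{eval}(\mathsf{KB},q_i)$, the following holds: for any censor $\mathsf{Cens}'$ (not required to have any of the other properties) with $\mathsf{Cens}'_P(q)|_{i-1}=\mathsf{Cens}_P(q)|_{i-1}$ and $\mathsf{Cens}'_P(q)_i=\mathsf{eval}(\mathsf{KB},q_i)$ there is an $n$ such that $\mathsf{cont}(\mathsf{Cens}'_P(q),n)\models\Box s$ for some $s\in\mathsf{Sec}$, or $\mathsf{cont}(\mathsf{Cens}'_P(q),n)$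 is not satisfiable. -}

module Defs where

open import Level using (0ℓ)
open import Data.Empty.Polymorphic using (⊥)
open import Data.Fin.Base using (Fin; toℕ)
open import Data.Nat.Base using (ℕ; _<_)
open import Data.Product.Base using (_×_; ∃; ∃-syntax)
open import Data.Sum.Base using (_⊎_)
open import Data.Vec.Base using (Vec; tabulate)
open import Function.Base using (_∘_)
open import Function.Bundles using (_↔_)
open import Relation.Binary.PropositionalEquality.Core using (_≡_; _≢_)
open import Relation.Nullary.Negation.Core using (¬_)
open import Relation.Unary using (Pred; _∈_; _∪_; _≐_)

infix  10 ¬ₗ_ ¬ₘ_ □_
infixr 7 _∧ₗ_ _∧ₘ_
infixr 6 _∨ₗ_ _∨ₘ_
infixr 5 _⇒ₗ_ _⇒ₘ_
infix  4 _⊢_ _⊩_ _⊩ˢ_ _⊨_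
infixl 8 _↾_

private variable
  Atom X : Set

Infinite : Set → Set
Infinite X = ∀ n → ¬ (Fin n ↔ X)

------------------------------------------------------------------------
-- Classical propositional logic L

data Fmlₗ (Atom : Set) : Set where
  atom           : Atom → Fmlₗ Atom
  ⊥ₗ             : Fmlₗ Atom
  _∧ₗ_ _∨ₗ_ _⇒ₗ_ : Fmlₗ Atom → Fmlₗ Atom → Fmlₗ Atom

¬ₗ_ : Fmlₗ Atom → Fmlₗ Atom
¬ₗ A = A ⇒ₗ ⊥ₗ

-- A Hilbert calculus; ex falso follows from K and double negation.
data _⊢_ {Atom : Set} (Γ : Pred (Fmlₗ Atom) 0ℓ) : Fmlₗ Atom → Set where
  hyp : ∀ {A} → A ∈ Γ → Γ ⊢ A
  mp  : ∀ {A B} → Γ ⊢ A ⇒ₗ B → Γ ⊢ A → Γ ⊢ B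
  K   : ∀ {A B} → Γ ⊢ A ⇒ₗ B ⇒ₗ A
  S   : ∀ {A B C} → Γ ⊢ (A ⇒ₗ B ⇒ₗ C) ⇒ₗ (A ⇒ₗ B) ⇒ₗ A ⇒ₗ C
  ∧I  : ∀ {A B} → Γ ⊢ A ⇒ₗ B ⇒ₗ A ∧ₗ B
  ∧E₁ : ∀ {A B} → Γ ⊢ A ∧ₗ B ⇒ₗ A
  ∧E₂ : ∀ {A B} → Γ ⊢ A ∧ₗ B ⇒ₗ B
  ∨I₁ : ∀ {A B} → Γ ⊢ A ⇒ₗ A ∨ₗ B
  ∨I₂ : ∀ {A B} → Γ ⊢ B ⇒ₗ A ∨ₗ B
  ∨E  : ∀ {A B C} → Γ ⊢ (A ⇒ₗ C) ⇒ₗ (B ⇒ₗ C) ⇒ₗ A ∨ₗ B ⇒ₗ C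
  dne : ∀ {A} → Γ ⊢ ¬ₗ ¬ₗ A ⇒ₗ A

Consistent : Pred (Fmlₗ Atom) 0ℓ → Set
Consistent Γ = ∃[ A ] ¬ (Γ ⊢ A)

------------------------------------------------------------------------
-- The modal logic M over L

data Fmlₘ (Atom : Set) : Set where
  □_   : Fmlₗ Atom → Fmlₘ Atom
  ⊥ₘ   : Fmlₘ Atom
  _⇒ₘ_ : Fmlₘ Atom → Fmlₘ Atom → Fmlₘ Atom

¬ₘ_ : Fmlₘ Atom → Fmlₘ Atom
¬ₘ A = A ⇒ₘ ⊥ₘ

⊤ₘ : Fmlₘ Atom
⊤ₘ = ¬ₘ ⊥ₘ

_∨ₘ_ _∧ₘ_ : Fmlₘ Atom → Fmlₘ Atom → Fmlₘ Atom
A ∨ₘ B = ¬ₘ A ⇒ₘ B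
A ∧ₘ B = ¬ₘ (A ⇒ₘ ¬ₘ B)

Model : Set → Set₁
Model Atom = Pred (Pred (Fmlₗ Atom) 0ℓ) 0ℓ

_⊩_ : Model Atom → Fmlₘ Atom → Set₁
M ⊩ □ A      = ∀ w → w ∈ M → w ⊢ A
M ⊩ ⊥ₘ       = ⊥
M ⊩ (A ⇒ₘ B) = ¬ (M ⊩ A) ⊎ M ⊩ B

_⊩ˢ_ : Model Atom → Pred (Fmlₘ Atom) 0ℓ → Set₁
M ⊩ˢ Γ = ∀ A → A ∈ Γ → M ⊩ A

Satisfiable : Pred (Fmlₘ Atom) 0ℓ → Set₁
Satisfiable Γ = ∃[ M ] M ⊩ˢ Γ

_⊨_ : Pred (Fmlₘ Atom) 0ℓ → Fmlₘ Atom → Set₁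
Γ ⊨ A = ∀ M → M ⊩ˢ Γ → M ⊩ A

-- Sets of formulas are equal when they have the same elements, so the
-- one-element model is taken up to _≐_ (unlike Relation.Unary.｛_｝,
-- which uses _≡_).
singleton : Pred (Fmlₗ Atom) 0ℓ → Model Atom
singleton Γ w = w ≐ Γ

------------------------------------------------------------------------
-- Atomic privacy configurations

record PrivacyConfiguration (Atom : Set) : Set₁ where
  field
    KB  : Pred (Fmlₗ Atom) 0ℓ
    AK  : Pred (Fmlₘ Atom) 0ℓ
    Sec : Pred (Fmlₗ Atom) 0ℓ
    KB-consistent : Consistent KB
    AK-true       : singleton KB ⊩ˢ AK
    AK-safe       : ∀ s → s ∈ Sec → ¬ (AK ⊨ □ s)

data Literal (Atom : Set) : Set where
  pos neg : Atom → Literal Atom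

∣_∣ : Literal Atom → Atom
∣ pos p ∣ = p
∣ neg p ∣ = p

⌜_⌝ : Literal Atom → Fmlₗ Atom
⌜ pos p ⌝ = atom p
⌜ neg p ⌝ = ¬ₗ atom p

complement : Literal Atom → Literal Atom
complement (pos p) = neg p
complement (neg p) = pos p

record AtomicConfiguration (Atom : Set) : Set₁ where
  field
    configuration : PrivacyConfiguration Atom
  open PrivacyConfiguration configuration public
  field
    KB-literal : ∀ A → A ∈ KB → ∃[ l ] A ≡ ⌜ l ⌝
    AK-literal : ∀ l l′ → ∣ l ∣ ≢ ∣ l′ ∣ →
      □ (⌜ l ⌝ ⇒ₗ ⌜ l′ ⌝) ⇒ₘ (□ ⌜ complement l ⌝ ∨ₘ □ ⌜ l′ ⌝) ∈ AK

open AtomicConfiguration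

------------------------------------------------------------------------
-- Censors

data Answer : Set where
  t u r : Answer

-- The graph of eval, since derivability from an arbitrary set of formulas
-- cannot be decided by a function.
Eval : Pred (Fmlₗ Atom) 0ℓ → Fmlₗ Atom → Answer → Set
Eval Γ A t = Γ ⊢ A
Eval Γ A u = ¬ (Γ ⊢ A)
Eval Γ A r = ⊥

-- Indices start at 0.
Seq : Set → Set
Seq X = ℕ → X

_↾_ : Seq X → (n : ℕ) → Vec X n
s ↾ n = tabulate (s ∘ toℕ)

Censor : Set → Set₁
Censor Atom = AtomicConfiguration Atom → Seq (Fmlₗ Atom) → Seq Answer

cont : Fmlₗ Atom → Answer → Fmlₘ Atom
cont A t = □ A
cont A u = ¬ₘ □ A
cont A r = ⊤ₘ

content : Censor Atom → AtomicConfiguration Atom → Seq (Fmlₗ Atom) → ℕ →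
          Pred (Fmlₘ Atom) 0ℓ
content C P q n =
  (λ A → ∃[ i ] i < n × A ≡ cont (q i) (C P q i)) ∪ AK P

Continuous : Censor Atom → Set₁
Continuous C = ∀ P q q′ n → q ↾ n ≡ q′ ↾ n → C P q ↾ n ≡ C P q′ ↾ n

NonRefusing : Censor Atom → Set₁
NonRefusing C = ∀ P q i → C P q i ≢ r

Credible : Censor Atom → Set₁
Credible C = ∀ P q n → Satisfiable (content C P q n)

Effective : Censor Atom → Set₁
Effective C = ∀ P q n s → s ∈ Sec P → ¬ (content C P q n ⊨ □ s)

MinimallyInvasive : Censor Atom → Set₁
MinimallyInvasive {Atom} C =
  Effective C × Credible C ×
  (∀ P q i → ¬ Eval (KB P) (q i) (C P q i) →
   ∀ (C′ : Censor Atom) →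
   C′ P q ↾ i ≡ C P q ↾ i → Eval (KB P) (q i) (C′ P q i) →
   ∃[ n ] ((∃[ s ] s ∈ Sec P × content C′ P q n ⊨ □ s)
           ⊎ ¬ Satisfiable (content C′ P q n)))

{-# OPTIONS --safe #-}
-- A non-refusing effective censor already fails on the a priori knowledge
-- □ p ∨ □ ¬ p with secrets p and ¬ p: asked p, the answer t reveals p and the
-- answer u reveals ¬ p.  To make this an atomic configuration, let KB be the
-- set of all literals true under some valuation: such a set decides every
-- literal, so the required implications between literals hold in it.  The
-- constantly true and the constantly false valuation refute the two secrets.
-- Equality of atoms need not be decidable, so KB cannot be just { p }.
module Submission where

open import Level using (0ℓ)
open import Data.Bool.Base using (Bool; true; false; not; _∧_; _∨_)
open import Data.Empty using (⊥-elim)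
open import Data.Nat.Base using (z<s)
open import Data.Product.Base using (_×_; _,_; ∃; ∃-syntax)
open import Data.Sum.Base using (inj₁; inj₂)
open import Function.Base using (const; id; case_of_)
open import Function.Bundles using (mk↔ₛ′)
open import Relation.Binary.PropositionalEquality
  using (_≡_; refl; sym; trans; cong)
open import Relation.Nullary.Negation.Core using (¬_)
open import Relation.Unary using (Pred; _∈_; _∪_)
open import Defs

private variable
  Atom : Set

infixr 4 _⇒ᵇ_

_⇒ᵇ_ : Bool → Bool → Bool
x ⇒ᵇ y = not x ∨ y

⟦_⟧ : Fmlₗ Atom → (Atom → Bool) → Bool
⟦ atom p ⟧ v = v p
⟦ ⊥ₗ ⟧     v = false
⟦ A ∧ₗ B ⟧ v = ⟦ A ⟧ v ∧ ⟦ B ⟧ v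
⟦ A ∨ₗ B ⟧ v = ⟦ A ⟧ v ∨ ⟦ B ⟧ v
⟦ A ⇒ₗ B ⟧ v = ⟦ A ⟧ v ⇒ᵇ ⟦ B ⟧ v

K-valid : ∀ x y → (x ⇒ᵇ y ⇒ᵇ x) ≡ true
K-valid false y     = refl
K-valid true  false = refl
K-valid true  true  = refl

S-valid : ∀ x y z → ((x ⇒ᵇ y ⇒ᵇ z) ⇒ᵇ (x ⇒ᵇ y) ⇒ᵇ x ⇒ᵇ z) ≡ true
S-valid false y     z     = refl
S-valid true  false z     = refl
S-valid true  true  false = refl
S-valid true  true  true  = refl

∧I-valid : ∀ x y → (x ⇒ᵇ y ⇒ᵇ x ∧ y) ≡ true
∧I-valid false y     = refl
∧I-valid true  false = refl
∧I-valid true  true  = refl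

∧E₁-valid : ∀ x y → (x ∧ y ⇒ᵇ x) ≡ true
∧E₁-valid false y     = refl
∧E₁-valid true  false = refl
∧E₁-valid true  true  = refl

∧E₂-valid : ∀ x y → (x ∧ y ⇒ᵇ y) ≡ true
∧E₂-valid false y     = refl
∧E₂-valid true  false = refl
∧E₂-valid true  true  = refl

∨I₁-valid : ∀ x y → (x ⇒ᵇ x ∨ y) ≡ true
∨I₁-valid false y = refl
∨I₁-valid true  y = refl

∨I₂-valid : ∀ x y → (y ⇒ᵇ x ∨ y) ≡ true
∨I₂-valid x     false = refl
∨I₂-valid false true  = refl
∨I₂-valid true  true  = refl

∨E-valid : ∀ x y z → ((x ⇒ᵇ z) ⇒ᵇ (y ⇒ᵇ z) ⇒ᵇ x ∨ y ⇒ᵇ z) ≡ true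
∨E-valid false false z     = refl
∨E-valid false true  false = refl
∨E-valid false true  true  = refl
∨E-valid true  y     false = refl
∨E-valid true  false true  = refl
∨E-valid true  true  true  = refl

dne-valid : ∀ x → (((x ⇒ᵇ false) ⇒ᵇ false) ⇒ᵇ x) ≡ true
dne-valid false = refl
dne-valid true  = refl

mp-valid : ∀ {x y} → (x ⇒ᵇ y) ≡ true → x ≡ true → y ≡ true
mp-valid e refl = e

-- Induction on the derivation, every axiom being a Boolean tautology. Underivability from a diagram
-- then needs only that its valuation makes the formula false.
⊢-sound : ∀ {Γ : Pred (Fmlₗ Atom) 0ℓ} {A} v →
          (∀ {B} → B ∈ Γ → ⟦ B ⟧ v ≡ true) → Γ ⊢ A → ⟦ A ⟧ v ≡ true
⊢-sound v Γ-true (hyp A∈Γ) = Γ-true A∈Γ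
⊢-sound v Γ-true (mp d e)  = mp-valid (⊢-sound v Γ-true d) (⊢-sound v Γ-true e)
⊢-sound v _ (K {A} {B})       = K-valid (⟦ A ⟧ v) (⟦ B ⟧ v)
⊢-sound v _ (S {A} {B} {C})   = S-valid (⟦ A ⟧ v) (⟦ B ⟧ v) (⟦ C ⟧ v)
⊢-sound v _ (∧I {A} {B})      = ∧I-valid (⟦ A ⟧ v) (⟦ B ⟧ v)
⊢-sound v _ (∧E₁ {A} {B})     = ∧E₁-valid (⟦ A ⟧ v) (⟦ B ⟧ v)
⊢-sound v _ (∧E₂ {A} {B})     = ∧E₂-valid (⟦ A ⟧ v) (⟦ B ⟧ v)
⊢-sound v _ (∨I₁ {A} {B})     = ∨I₁-valid (⟦ A ⟧ v) (⟦ B ⟧ v)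
⊢-sound v _ (∨I₂ {A} {B})     = ∨I₂-valid (⟦ A ⟧ v) (⟦ B ⟧ v)
⊢-sound v _ (∨E {A} {B} {C})  = ∨E-valid (⟦ A ⟧ v) (⟦ B ⟧ v) (⟦ C ⟧ v)
⊢-sound v _ (dne {A})         = dne-valid (⟦ A ⟧ v)

-- Truth is required of `A` rather than of `⌜ l ⌝`, so soundness reads it off without matching on
-- the equation.
Diagram : (Atom → Bool) → Pred (Fmlₗ Atom) 0ℓ
Diagram v A = ∃[ l ] A ≡ ⌜ l ⌝ × ⟦ A ⟧ v ≡ true

Diagram-sound : ∀ {v : Atom → Bool} {A} → Diagram v ⊢ A → ⟦ A ⟧ v ≡ true
Diagram-sound {v = v} = ⊢-sound v (λ (_ , _ , true-A) → true-A)

Diagram-consistent : (v : Atom → Bool) → Consistent (Diagram v)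
Diagram-consistent v = ⊥ₗ , λ d → case Diagram-sound d of λ ()

complement-true : ∀ (l : Literal Atom) v →
                  ⟦ ⌜ l ⌝ ⟧ v ≡ false → ⟦ ⌜ complement l ⌝ ⟧ v ≡ true
complement-true (pos p) v e rewrite e = refl
complement-true (neg p) v e with v p
... | true = refl

Diagram-⊩□ : ∀ {v : Atom → Bool} l → ⟦ ⌜ l ⌝ ⟧ v ≡ true →
             singleton (Diagram v) ⊩ □ ⌜ l ⌝
Diagram-⊩□ l true-l w (_ , Diagram⊆w) = hyp (Diagram⊆w (l , refl , true-l))

Diagram-⊮□ : ∀ {v : Atom → Bool} {A} → ⟦ A ⟧ v ≡ false →
             ¬ (singleton (Diagram v) ⊩ □ A)
Diagram-⊮□ {v = v} false-A h =
  case trans (sym false-A) (Diagram-sound (h (Diagram v) (id , id))) of λ ()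

-- `A ∨ₘ B` unfolds to `¬ₘ A ⇒ₘ B`, whose truth is a constructive choice; a true `A` selects the
-- side refuting `¬ₘ A`.
∨ₘ-inj₁ : ∀ {M : Model Atom} {A B} → M ⊩ A → M ⊩ A ∨ₘ B
∨ₘ-inj₁ a = inj₁ λ { (inj₁ ¬a) → ¬a a }

∨ₘ-elim : ∀ {M : Model Atom} {A B} → M ⊩ A ∨ₘ B → M ⊩ ¬ₘ A → M ⊩ B
∨ₘ-elim (inj₁ ¬¬a) ¬a = ⊥-elim (¬¬a ¬a)
∨ₘ-elim (inj₂ b)   _  = b

-- A false `l` puts its complement into the diagram, and a true `l′` lies there itself. In the
-- remaining case the implication is false under `v`, so its box fails.
Diagram-⊩-literal : ∀ (v : Atom → Bool) l l′ → singleton (Diagram v) ⊩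
  □ (⌜ l ⌝ ⇒ₗ ⌜ l′ ⌝) ⇒ₘ (□ ⌜ complement l ⌝ ∨ₘ □ ⌜ l′ ⌝)
Diagram-⊩-literal v l l′ with ⟦ ⌜ l ⌝ ⟧ v in l-value | ⟦ ⌜ l′ ⌝ ⟧ v in l′-value
... | false | _     = inj₂ (∨ₘ-inj₁ {A = □ ⌜ complement l ⌝} {□ ⌜ l′ ⌝}
                        (Diagram-⊩□ (complement l) (complement-true l v l-value)))
... | true  | true  = inj₂ (inj₂ (Diagram-⊩□ l′ l′-value))
... | true  | false = inj₁ (Diagram-⊮□ l⇒l′-false)
  where
  l⇒l′-false : ⟦ ⌜ l ⌝ ⇒ₗ ⌜ l′ ⌝ ⟧ v ≡ false
  l⇒l′-false rewrite l-value | l′-value = refl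

module _ (p : Atom) where

  -- With the boxes inside the disjunction this is no tautology: it fails when neither `p` nor `¬ p`
  -- is derivable.
  excludedMiddle : Fmlₘ Atom
  excludedMiddle = □ atom p ∨ₘ □ ¬ₗ atom p

  -- The instances for l and l′ over the same atom are included too: they also
  -- hold in every singleton (Diagram v).
  knowledge : Pred (Fmlₘ Atom) 0ℓ
  knowledge =
    (λ A → ∃[ l ] ∃[ l′ ]
       A ≡ (□ (⌜ l ⌝ ⇒ₗ ⌜ l′ ⌝) ⇒ₘ (□ ⌜ complement l ⌝ ∨ₘ □ ⌜ l′ ⌝)))
    ∪ (_≡ excludedMiddle)

  secrets : Pred (Fmlₗ Atom) 0ℓ
  secrets = (_≡ atom p) ∪ (_≡ ¬ₗ atom p)

  -- Stated for every `v` because safety needs countermodels other than the actual `KB`.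
  knowledge-true : ∀ v → singleton (Diagram v) ⊩ˢ knowledge
  knowledge-true v _ (inj₁ (l , l′ , refl)) = Diagram-⊩-literal v l l′
  knowledge-true v _ (inj₂ refl) with v p in p-value
  ... | true  = ∨ₘ-inj₁ {A = □ atom p} {□ ¬ₗ atom p} (Diagram-⊩□ (pos p) p-value)
  ... | false = inj₂ (Diagram-⊩□ (neg p) (complement-true (pos p) v p-value))

  knowledge-safe : ∀ s → s ∈ secrets → ¬ (knowledge ⊨ □ s)
  knowledge-safe _ (inj₁ refl) h =
    Diagram-⊮□ refl (h _ (knowledge-true (const false)))
  knowledge-safe _ (inj₂ refl) h =
    Diagram-⊮□ refl (h _ (knowledge-true (const true)))

  leaky : AtomicConfiguration Atom
  leaky = record
    { configuration = record
      { KB            = Diagram (const true)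
      ; AK            = knowledge
      ; Sec           = secrets
      ; KB-consistent = Diagram-consistent (const true)
      ; AK-true       = knowledge-true (const true)
      ; AK-safe       = knowledge-safe
      }
    ; KB-literal = λ _ (l , A≡l , _) → l , A≡l
    ; AK-literal = λ l l′ _ → inj₁ (l , l′ , refl)
    }

  leaky-refuses : ∀ {C : Censor Atom} → Effective C → ¬ NonRefusing C
  leaky-refuses {C} effective nonRefusing with C leaky (const (atom p)) 0 in answer
  ... | r = nonRefusing leaky (const (atom p)) 0 answer
  -- Length `1` covers exactly the answer at index `0`, whose content is here the boxed secret
  -- itself.
  ... | t = effective leaky (const (atom p)) 1 (atom p) (inj₁ refl)
    λ M h → h _ (inj₁ (0 , z<s , cong (cont (atom p)) (sym answer)))
  -- The answer contributes `¬ₘ □ atom p`, which removes the left disjunct of `excludedMiddle`.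
  ... | u = effective leaky (const (atom p)) 1 (¬ₗ atom p) (inj₂ refl)
    λ M h → ∨ₘ-elim {A = □ atom p} {□ ¬ₗ atom p}
      (h excludedMiddle (inj₂ (inj₂ refl)))
      (h _ (inj₁ (0 , z<s , cong (cont (atom p)) (sym answer))))

-- An empty `X` would be in bijection with `Fin 0`. The double negation suffices, since an atom is
-- needed only to derive a contradiction.
infinite⇒¬¬inhabited : ∀ {X} → Infinite X → ¬ ¬ X
infinite⇒¬¬inhabited infinite ¬x =
  infinite 0 (mk↔ₛ′ (λ ()) (λ x → ⊥-elim (¬x x)) (λ x → ⊥-elim (¬x x)) (λ ()))

theorem27 : ∀ (Atom : Set) → Infinite Atom →
    ¬ (∃ λ (C : Censor Atom) →
    Continuous C × NonRefusing C × Effective C × MinimallyInvasive C)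
theorem27 Atom infinite (C , _ , nonRefusing , effective , _) =
  infinite⇒¬¬inhabited infinite λ p → leaky-refuses p effective nonRefusing
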